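{- Let $s,t,q,N$ be integers with $0\le s<q$, $1\le t<q$, $N\ge0$, $t\nmid q$ and $\gcd(t,q)=1$. Write $q=\overline qt+\widehat q$ ($1\le\widehat q<t$), $s=\overline st+\widehat s$ ($0\le\widehat s<t$). Let $S^+(s,t,q,N)=\sum_{k=0}^N\lfloor(s+kt)/q\rfloor$, $M=\lfloor(s+Nt)/q\rfloor$, $x_M=(Mq-s)/t$ and $S=\overline q\frac{(M-1)M}2+M(N-\lceil x_M\rceil+1)$. Let $H=\{k\in\mathbb N:(\widehat s-k\widehat q)\bmod t<\widehat q\}$ (the hS-type indices), $J=H\cap\{0,\dots,t-1\}=\{j_0<j_1<\dots<j_{\widehat q-1}\}$, and for a finite set $K$ let $S_K=\sum_{k\in K}k$. Then: (a) if $j_0\ge M$, $S^+(s,t,q,N)=S$; (b.1) if $j_0<M\le j_{\widehat q-1}$, then $S^+(s,t,q,N)=S+S_K$ with $K=H\cap\{0,\dots,M-1\}$; (b.2) if $j_{\widehat q-1}<M$ and $j_0+t\ge M$, then $S^+(s,t,q,N)=S+S_J$; (b.3) if $j_{\widehat q-1}<M$ and $j_0+t<M$, set $u=\lfloor(M-1)/t\rfloor$ and $K=H\cap\{ut,\dots,M-1\}$; then $S^+(s,t,q,N)=S+uS_J+\widehat q\,t\frac{(u-1)u}2+S_K$.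
   Context: Here $r\bmod t$ denotes the representative of $r$ in $\{0,\dots,t-1\}$. -}

module Defs where

open import Data.Nat.Base as ℕ
  using (ℕ; zero; suc; NonZero; _≤_; _<_; _∸_; s≤s; z≤n; >-nonZero)
import Data.Nat.Properties as ℕ
import Data.Nat.DivMod as ℕ
open import Data.Nat.Divisibility using (_∣_; divides; m%n≡0⇒n∣m; >⇒∤)
open import Data.Integer.Base as ℤ using (ℤ; +_; 1ℤ; _/ℕ_; _%ℕ_; ∣_∣)
import Data.Integer.Properties as ℤ
open import Data.Integer.DivMod using (n%ℕd<d; a≡a%ℕn+[a/ℕn]*n)
open import Data.Integer.Solver using (module +-*-Solver)
open import Data.Rational.Base as ℚ using (ℚ; ceiling)
open import Data.Fin.Base using (Fin; fromℕ<; cast)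
open import Data.List.Base using (List; []; _∷_; length; lookup; filter; map; upTo; applyUpTo)
open import Data.Nat.ListAction using (sum)
open import Data.List.Properties using (filter-++; filter-accept; filter-reject; length-++; upTo-∷ʳ)
open import Function.Base using (_∘_)
open import Relation.Nullary using (¬_; yes; no; contradiction)
open import Relation.Unary using (Pred; Decidable)
open import Relation.Binary.PropositionalEquality
  using (_≡_; refl; sym; trans; cong; cong₂; subst; subst₂; module ≡-Reasoning)
open import Level using (0ℓ)

-- The integers a, …, b - 1 in increasing order.
[_⋯_⟩ : ℕ → ℕ → List ℕ
[ a ⋯ b ⟩ = applyUpTo (a ℕ.+_) (b ∸ a)

-- (n - 1) n / 2; the division is exact.
△ : ℤ → ℤ
△ n = ((n ℤ.- 1ℤ) ℤ.* n) /ℕ 2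

module FloorSum (s t q N : ℕ) (1≤t : 1 ≤ t) (t<q : t < q) (t∤q : ¬ (t ∣ q)) where

  instance
    t≢0 : NonZero t
    t≢0 = >-nonZero 1≤t

    q≢0 : NonZero q
    q≢0 = >-nonZero (ℕ.≤-<-trans z≤n t<q)

  q̄ q̂ s̄ ŝ : ℕ
  q̄ = q ℕ./ t
  q̂ = q ℕ.% t
  s̄ = s ℕ./ t
  ŝ = s ℕ.% t

  S⁺ : ℕ
  S⁺ = sum (map (λ k → (s ℕ.+ k ℕ.* t) ℕ./ q) (upTo (suc N)))

  M : ℕ
  M = (s ℕ.+ N ℕ.* t) ℕ./ q

  xM : ℚ
  xM = (+ M ℤ.* + q ℤ.- + s) ℚ./ t

  S : ℤ
  S = + q̄ ℤ.* △ (+ M) ℤ.+ + M ℤ.* (+ N ℤ.- ⌈ xM ⌉ ℤ.+ 1ℤ)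

  numerator : ℕ → ℤ
  numerator k = + ŝ ℤ.- + k ℤ.* + q̂

  residue : ℕ → ℕ
  residue k = numerator k %ℕ t

  H : Pred ℕ 0ℓ
  H k = residue k < q̂

  H? : Decidable H
  H? k = residue k ℕ.<? q̂

  -- The finite sets H ∩ {a, …, b - 1}, as increasing lists.
  H∩[_⋯_⟩ : ℕ → ℕ → List ℕ
  H∩[ a ⋯ b ⟩ = filter H? [ a ⋯ b ⟩

  J : List ℕ
  J = H∩[ 0 ⋯ t ⟩

  unique-residue : ∀ {x y} z → x < t → y < t → + x ℤ.- + y ≡ z ℤ.* + t → x ≡ y
  unique-residue {x} {y} z x<t y<t eq =
    ℤ.+-injective (ℤ.i-j≡0⇒i≡j (+ x) (+ y) (ℤ.∣i∣≡0⇒i≡0 (small ∣ + x ℤ.- + y ∣ d<t t∣d)))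
    where
    d<t : ∣ + x ℤ.- + y ∣ < t
    d<t = subst (λ i → ∣ i ∣ < t) (sym (ℤ.m-n≡m⊖n x y))
            (ℕ.≤-<-trans (ℤ.∣m⊝n∣≤m⊔n x y) (ℕ.⊔-pres-<m x<t y<t))
    t∣d : t ∣ ∣ + x ℤ.- + y ∣
    t∣d = divides ∣ z ∣ (trans (cong ∣_∣ eq) (ℤ.abs-* z (+ t)))
    small : ∀ d → d < t → t ∣ d → d ≡ 0
    small zero    _   _   = refl
    small (suc d) d<t t∣d = contradiction t∣d (>⇒∤ d<t)

  residue-eq : ∀ k → + residue k ≡ numerator k ℤ.- (numerator k /ℕ t) ℤ.* + t
  residue-eq k = trans
    (solve 2 (λ r m → r := (r :+ m) :- m) refl (+ residue k) ((numerator k /ℕ t) ℤ.* + t))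
    (cong (ℤ._- ((numerator k /ℕ t) ℤ.* + t)) (sym (a≡a%ℕn+[a/ℕn]*n (numerator k) t)))
    where open +-*-Solver

  residue<t : ∀ k → residue k < t
  residue<t k = n%ℕd<d (numerator k) t

  residue-congruence : ∀ m k i → + m ≡ + k ℤ.+ i →
    + residue m ℤ.- + residue k ≡
    (numerator k /ℕ t ℤ.- numerator m /ℕ t) ℤ.* + t ℤ.- i ℤ.* + q̂
  residue-congruence m k i m≡k+i = begin
    + residue m ℤ.- + residue k
      ≡⟨ cong₂ ℤ._-_ (residue-eq m) (residue-eq k) ⟩
    (numerator m ℤ.- B ℤ.* + t) ℤ.- (numerator k ℤ.- A ℤ.* + t)
      ≡⟨ cong (λ n → ((+ ŝ ℤ.- n ℤ.* + q̂) ℤ.- B ℤ.* + t) ℤ.- (numerator k ℤ.- A ℤ.* + t)) m≡k+i ⟩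
    ((+ ŝ ℤ.- (+ k ℤ.+ i) ℤ.* + q̂) ℤ.- B ℤ.* + t) ℤ.- (numerator k ℤ.- A ℤ.* + t)
      ≡⟨ solve 7 (λ a b i k s q t →
           ((s :- (k :+ i) :* q) :- b :* t) :- ((s :- k :* q) :- a :* t) := (a :- b) :* t :- i :* q)
           refl A B i (+ k) (+ ŝ) (+ q̂) (+ t) ⟩
    (A ℤ.- B) ℤ.* + t ℤ.- i ℤ.* + q̂ ∎
    where
    open +-*-Solver
    open ≡-Reasoning
    A = numerator k /ℕ t
    B = numerator m /ℕ t

  residue-t : residue t ≡ residue 0
  residue-t = unique-residue (A ℤ.- B ℤ.- + q̂) (residue<t t) (residue<t 0)
    (trans (residue-congruence t 0 (+ t) refl)
      (solve 4 (λ a b q t → (a :- b) :* t :- t :* q := (a :- b :- q) :* t) refl A B (+ q̂) (+ t)))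
    where
    open +-*-Solver
    A = numerator 0 /ℕ t
    B = numerator t /ℕ t

  step : ∀ k {y} e → y < t → + y ≡ + residue k ℤ.+ e ℤ.* + t ℤ.- + q̂ → residue (suc k) ≡ y
  step k {y} e y<t eq = unique-residue (A ℤ.- B ℤ.- e) (residue<t (suc k)) y<t
    (begin
      + residue (suc k) ℤ.- + y
        ≡⟨ cong (λ i → + residue (suc k) ℤ.- i) eq ⟩
      + residue (suc k) ℤ.- (+ residue k ℤ.+ e ℤ.* + t ℤ.- + q̂)
        ≡⟨ solve 5 (λ r′ r e t q → r′ :- (r :+ e :* t :- q) := (r′ :- r) :- (e :* t :- q)) refl
             (+ residue (suc k)) (+ residue k) e (+ t) (+ q̂) ⟩
      (+ residue (suc k) ℤ.- + residue k) ℤ.- (e ℤ.* + t ℤ.- + q̂)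
        ≡⟨ cong (ℤ._- (e ℤ.* + t ℤ.- + q̂))
             (residue-congruence (suc k) k 1ℤ (cong +_ (ℕ.+-comm 1 k))) ⟩
      ((A ℤ.- B) ℤ.* + t ℤ.- 1ℤ ℤ.* + q̂) ℤ.- (e ℤ.* + t ℤ.- + q̂)
        ≡⟨ solve 5 (λ a b q t e →
             ((a :- b) :* t :- con 1ℤ :* q) :- (e :* t :- q) := (a :- b :- e) :* t)
             refl A B (+ q̂) (+ t) e ⟩
      (A ℤ.- B ℤ.- e) ℤ.* + t ∎)
    where
    open +-*-Solver
    open ≡-Reasoning
    A = numerator k /ℕ t
    B = numerator (suc k) /ℕ t

  +-∸ : ∀ {m n} → n ≤ m → + (m ∸ n) ≡ + m ℤ.- + n
  +-∸ {m} {n} n≤m = trans (sym (ℤ.⊖-≥ n≤m)) (sym (ℤ.m-n≡m⊖n m n))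

  q̂≤t : q̂ ≤ t
  q̂≤t = ℕ.<⇒≤ (ℕ.m%n<n q t)

  step-H : ∀ k → H k → residue (suc k) ℕ.+ q̂ ≡ residue k ℕ.+ t
  step-H k r<q̂ = trans (cong (ℕ._+ q̂) (step k 1ℤ y<t eq)) (ℕ.m∸n+n≡m q̂≤r+t)
    where
    q̂≤r+t : q̂ ≤ residue k ℕ.+ t
    q̂≤r+t = ℕ.≤-trans q̂≤t (ℕ.m≤n+m t (residue k))
    y<t : residue k ℕ.+ t ∸ q̂ < t
    y<t = ℕ.+-cancelʳ-< q̂ _ _ (subst₂ _<_ (sym (ℕ.m∸n+n≡m q̂≤r+t)) (ℕ.+-comm q̂ t)
            (ℕ.+-monoˡ-< t r<q̂))
    eq : + (residue k ℕ.+ t ∸ q̂) ≡ + residue k ℤ.+ 1ℤ ℤ.* + t ℤ.- + q̂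
    eq = trans (+-∸ q̂≤r+t) (cong (λ i → + residue k ℤ.+ i ℤ.- + q̂) (sym (ℤ.*-identityˡ (+ t))))

  step-¬H : ∀ k → ¬ H k → residue (suc k) ℕ.+ q̂ ≡ residue k
  step-¬H k r≮q̂ = trans (cong (ℕ._+ q̂) (step k ℤ.0ℤ y<t eq)) (ℕ.m∸n+n≡m q̂≤r)
    where
    q̂≤r : q̂ ≤ residue k
    q̂≤r = ℕ.≮⇒≥ r≮q̂
    y<t : residue k ∸ q̂ < t
    y<t = ℕ.≤-<-trans (ℕ.m∸n≤m (residue k) q̂) (residue<t k)
    eq : + (residue k ∸ q̂) ≡ + residue k ℤ.+ ℤ.0ℤ ℤ.* + t ℤ.- + q̂
    eq = trans (+-∸ q̂≤r) (cong (ℤ._- + q̂) (sym (ℤ.+-identityʳ (+ residue k))))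

  count : ℕ → ℕ
  count n = length H∩[ 0 ⋯ n ⟩

  count-suc : ∀ n → count (suc n) ≡ count n ℕ.+ length (filter H? (n ∷ []))
  count-suc n = trans
    (cong (length ∘ filter H?) (sym (upTo-∷ʳ n)))
    (trans (cong length (filter-++ H? (upTo n) (n ∷ []))) (length-++ (filter H? (upTo n))))

  invariant : ∀ n → residue n ℕ.+ n ℕ.* q̂ ≡ residue 0 ℕ.+ count n ℕ.* t
  invariant zero = refl
  invariant (suc n) = begin
    residue (suc n) ℕ.+ (q̂ ℕ.+ n ℕ.* q̂)                   ≡⟨ ℕ.+-assoc (residue (suc n)) q̂ _ ⟨
    residue (suc n) ℕ.+ q̂ ℕ.+ n ℕ.* q̂                     ≡⟨ cong (ℕ._+ n ℕ.* q̂) new ⟩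
    c ℕ.* t ℕ.+ residue n ℕ.+ n ℕ.* q̂                     ≡⟨ ℕ.+-assoc (c ℕ.* t) _ _ ⟩
    c ℕ.* t ℕ.+ (residue n ℕ.+ n ℕ.* q̂)                   ≡⟨ cong (c ℕ.* t ℕ.+_) (invariant n) ⟩
    c ℕ.* t ℕ.+ (residue 0 ℕ.+ count n ℕ.* t)             ≡⟨ ℕ.+-comm (c ℕ.* t) _ ⟩
    residue 0 ℕ.+ count n ℕ.* t ℕ.+ c ℕ.* t               ≡⟨ ℕ.+-assoc (residue 0) _ _ ⟩
    residue 0 ℕ.+ (count n ℕ.* t ℕ.+ c ℕ.* t)             ≡⟨ cong (residue 0 ℕ.+_) (ℕ.*-distribʳ-+ t (count n) c) ⟨
    residue 0 ℕ.+ (count n ℕ.+ c) ℕ.* t                   ≡⟨ cong (λ m → residue 0 ℕ.+ m ℕ.* t) (count-suc n) ⟨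
    residue 0 ℕ.+ count (suc n) ℕ.* t                     ∎
    where
    open ≡-Reasoning
    c : ℕ
    c = length (filter H? (n ∷ []))
    new : residue (suc n) ℕ.+ q̂ ≡ c ℕ.* t ℕ.+ residue n
    new with H? n
    ... | yes h = trans (step-H n h) (trans (ℕ.+-comm (residue n) t)
                    (cong (ℕ._+ residue n) (trans (sym (ℕ.*-identityˡ t))
                      (cong (λ xs → length xs ℕ.* t) (sym (filter-accept H? {xs = []} h))))))
    ... | no ¬h = trans (step-¬H n ¬h)
                    (cong (λ xs → length xs ℕ.* t ℕ.+ residue n) (sym (filter-reject H? {xs = []} ¬h)))

  ∣J∣≡q̂ : length J ≡ q̂
  ∣J∣≡q̂ = ℕ.*-cancelʳ-≡ (length J) q̂ t (ℕ.+-cancelˡ-≡ (residue 0) _ _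
    (trans (sym (invariant t)) (cong₂ ℕ._+_ residue-t (ℕ.*-comm t q̂))))

  -- J = { j 0 < j 1 < ⋯ < j (q̂ - 1) }
  j : Fin q̂ → ℕ
  j i = lookup J (cast (sym ∣J∣≡q̂) i)

  1≤q̂ : 1 ≤ q̂
  1≤q̂ = ℕ.n≢0⇒n>0 (t∤q ∘ m%n≡0⇒n∣m q t)

  j-first j-last : ℕ
  j-first = j (fromℕ< 1≤q̂)
  j-last  = j (fromℕ< (ℕ.∸-monoʳ-< {q̂} {1} {0} (s≤s z≤n) 1≤q̂))

  -- ⌊ (M - 1) / t ⌋ when M ≥ 1, which holds wherever u is used.
  u : ℕ
  u = (M ∸ 1) ℕ./ t

-- Writing C m = ⌈x_m⌉ + s̄, counting lattice points under the line by rows instead of by columns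
-- gives S⁺ = Σ_{1≤m≤M} (N + 1 - ⌈x_m⌉).  Since ŝ - m q̂ mod t wraps around exactly at the indices in
-- H, C m = m q̄ + #(H ∩ {0,…,m-1}), and summation by parts yields S⁺ = S + Σ (H ∩ {0,…,M-1}) in all
-- cases.  The cases only evaluate the last sum, using that H is periodic modulo t.

module Submission where

open import Defs
open import Data.Nat.Base as ℕ using (ℕ; zero; suc; _≤_; _<_; _*_; _∸_; z≤n; s≤s; s≤s⁻¹; NonZero) renaming (_+_ to _+ℕ_)
import Data.Nat.DivMod as ℕ
open import Data.Nat.Divisibility using (_∣_)
open import Data.Nat.GCD using (gcd)
open import Data.Nat.ListAction using (sum)
open import Data.Nat.ListAction.Properties using (sum-++)
import Data.Nat.Properties as ℕ
import Data.Nat.Tactic.RingSolver as ℕ-Ring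
open import Data.Integer.Base as ℤ using (+_; _+_; 1ℤ) renaming (_*_ to _*ℤ_)
import Data.Integer.DivMod as ℤ
import Data.Integer.GCD as ℤ
import Data.Integer.Properties as ℤ
import Data.Integer.Tactic.RingSolver as ℤ-Ring
open import Data.Rational.Base as ℚ using (mkℚ; ceiling; ↥_; ↧_; ↧ₙ_)
import Data.Rational.Properties as ℚ
open import Data.Fin.Base as Fin using (toℕ; fromℕ<; cast)
import Data.Fin.Properties as Fin
open import Data.List.Base using ([]; _∷_; _++_; length; lookup; filter; map; upTo; applyUpTo)
open import Data.List.Properties using (filter-++; filter-none; map-upTo; upTo-∷ʳ; map-++)
open import Data.List.Membership.Propositional using (_∈_)
open import Data.List.Membership.Propositional.Properties using (∈-lookup; ∈-filter⁺; ∈-filter⁻; ∈-upTo⁺; ∈-upTo⁻)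
import Data.List.Relation.Unary.All as All
import Data.List.Relation.Unary.All.Properties as All
open import Data.List.Relation.Unary.AllPairs using (AllPairs; _∷_)
import Data.List.Relation.Unary.AllPairs.Properties as AllPairs
open import Data.List.Relation.Unary.Any using (index)
open import Data.List.Relation.Unary.Any.Properties using (lookup-index)
open import Data.Product.Base using (_×_; _,_; ∃; proj₁)
open import Data.Sum.Base as Sum using (_⊎_; inj₁; inj₂)
open import Function.Base using (_∘_; id)
open import Level using (0ℓ)
open import Relation.Nullary using (¬_; Dec; yes; no; contradiction)
open import Relation.Unary using (Pred; Decidable)
open import Relation.Binary.PropositionalEquality
  using (_≡_; refl; sym; trans; cong; cong₂; subst; subst₂; module ≡-Reasoning)

-- Finite sums and triangular numbers.

Σ< : (ℕ → ℕ) → ℕ → ℕ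
Σ< f zero    = 0
Σ< f (suc n) = Σ< f n +ℕ f n

sum-map-upTo : ∀ f n → sum (map f (upTo n)) ≡ Σ< f n
sum-map-upTo f zero    = refl
sum-map-upTo f (suc n) = begin
  sum (map f (upTo (suc n)))                ≡⟨ cong (sum ∘ map f) (upTo-∷ʳ n) ⟨
  sum (map f (upTo n ++ n ∷ []))            ≡⟨ cong sum (map-++ f (upTo n) (n ∷ [])) ⟩
  sum (map f (upTo n) ++ f n ∷ [])          ≡⟨ sum-++ (map f (upTo n)) (f n ∷ []) ⟩
  sum (map f (upTo n)) +ℕ (f n +ℕ 0)        ≡⟨ cong₂ _+ℕ_ (sum-map-upTo f n) (ℕ.+-identityʳ (f n)) ⟩
  Σ< f n +ℕ f n                             ∎
  where open ≡-Reasoning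

-- Doubled to keep division out of the induction; `n * suc n` is the product that `△` halves at
-- `suc n`.
2Σ<id : ∀ n → n * suc n ≡ Σ< id (suc n) * 2
2Σ<id zero    = refl
2Σ<id (suc n) = begin
  suc n * suc (suc n)              ≡⟨ expand n ⟩
  n * suc n +ℕ suc n * 2           ≡⟨ cong (_+ℕ suc n * 2) (2Σ<id n) ⟩
  Σ< id (suc n) * 2 +ℕ suc n * 2   ≡⟨ ℕ.*-distribʳ-+ 2 (Σ< id (suc n)) (suc n) ⟨
  Σ< id (suc (suc n)) * 2          ∎
  where
  open ≡-Reasoning
  expand : ∀ n → suc n * suc (suc n) ≡ n * suc n +ℕ suc n * 2
  expand = ℕ-Ring.solve-∀

△≡Σ<id : ∀ n → △ (+ n) ≡ + Σ< id n
△≡Σ<id zero    = refl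
△≡Σ<id (suc n) = begin
  (+ n *ℤ + suc n) ℤ./ℕ 2            ≡⟨ cong (ℤ._/ℕ 2) (ℤ.pos-* n (suc n)) ⟨
  + ((n * suc n) ℕ./ 2)              ≡⟨ cong (λ m → + (m ℕ./ 2)) (2Σ<id n) ⟩
  + ((Σ< id (suc n) * 2) ℕ./ 2)      ≡⟨ cong +_ (ℕ.m*n/n≡m (Σ< id (suc n)) 2) ⟩
  + Σ< id (suc n)                    ∎
  where open ≡-Reasoning

-- Floors and ceilings characterised by division with remainder.

n<[1+n/d]*d : ∀ n d .{{_ : NonZero d}} → n < suc (n ℕ./ d) * d
n<[1+n/d]*d n d = subst (_< suc (n ℕ./ d) * d) (sym (ℕ.m≡m%n+[m/n]*n n d))
  (ℕ.+-monoˡ-< (n ℕ./ d * d) (ℕ.m%n<n n d))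

-- `ceiling` is the negated floor of the negated rational, and that negation computes only when the
-- constructor of the numerator is known; hence the three cases.
ceiling-/ℕ : ∀ p → ceiling p ≡ ℤ.- ((ℤ.- ↥ p) ℤ./ℕ ↧ₙ p)
ceiling-/ℕ (mkℚ ℤ.+0       d _) = cong ℤ.-_ (ℤ.div-pos-is-/ℕ ℤ.+0 (suc d))
ceiling-/ℕ (mkℚ ℤ.+[1+ n ] d _) = cong ℤ.-_ (ℤ.div-pos-is-/ℕ ℤ.-[1+ n ] (suc d))
ceiling-/ℕ (mkℚ ℤ.-[1+ n ] d _) = cong ℤ.-_ (ℤ.div-pos-is-/ℕ ℤ.+[1+ n ] (suc d))

-- Here `a / d` is a reduced fraction and `g` the factor cancelled from it. The remainder bound puts
-- `- a / d` in the interval from `- c` (included) to `1 - c` (excluded), so its floor is `- c`.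
-- Both comparisons are made after scaling by `d * g`.
neg-/ℕ-unique : ∀ a d .{{_ : NonZero d}} g .{{_ : ℤ.Positive g}} c r →
  + r ℤ.< + d *ℤ g → c *ℤ (+ d *ℤ g) ≡ a *ℤ g + + r → ℤ.- ((ℤ.- a) ℤ./ℕ d) ≡ c
neg-/ℕ-unique a d g c r r<dg eq = trans (cong ℤ.-_ Q≡-c) (ℤ.neg-involutive c)
  where
  open ℤ.≤-Reasoning
  Q = (ℤ.- a) ℤ./ℕ d
  instance
    dg≥0 : ℤ.NonNegative (+ d *ℤ g)
    dg≥0 = ℤ.nonNegative (ℤ.≤-trans (ℤ.+≤+ z≤n) (ℤ.<⇒≤ r<dg))
    g≥0 : ℤ.NonNegative g
    g≥0 = ℤ.nonNegative (ℤ.<⇒≤ (ℤ.positive⁻¹ g))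
  -cdg : ℤ.- c *ℤ (+ d *ℤ g) ≡ ℤ.- a *ℤ g ℤ.- + r
  -cdg = trans (sym (ℤ.neg-distribˡ-* c _)) (trans (cong ℤ.-_ eq) (push a g (+ r)))
    where
    push : ∀ a g r → ℤ.- (a *ℤ g + r) ≡ ℤ.- a *ℤ g ℤ.- r
    push = ℤ-Ring.solve-∀
  -c<1+Q : ℤ.- c ℤ.< ℤ.suc Q
  -c<1+Q = ℤ.*-cancelʳ-<-nonNeg (+ d *ℤ g) (begin-strict
    ℤ.- c *ℤ (+ d *ℤ g)       ≡⟨ -cdg ⟩
    ℤ.- a *ℤ g ℤ.- + r        ≤⟨ ℤ.i-j≤i (ℤ.- a *ℤ g) (+ r) ⟩
    ℤ.- a *ℤ g                <⟨ ℤ.*-monoʳ-<-pos g (ℤ.n<s[n/ℕd]*d (ℤ.- a) d) ⟩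
    ℤ.suc Q *ℤ + d *ℤ g       ≡⟨ ℤ.*-assoc (ℤ.suc Q) (+ d) g ⟩
    ℤ.suc Q *ℤ (+ d *ℤ g)     ∎)
  Q<1-c : Q ℤ.< ℤ.suc (ℤ.- c)
  Q<1-c = ℤ.*-cancelʳ-<-nonNeg (+ d *ℤ g) (begin-strict
    Q *ℤ (+ d *ℤ g)                        ≡⟨ ℤ.*-assoc Q (+ d) g ⟨
    Q *ℤ + d *ℤ g                          ≤⟨ ℤ.*-monoʳ-≤-nonNeg g (ℤ.[n/ℕd]*d≤n (ℤ.- a) d) ⟩
    ℤ.- a *ℤ g                             ≡⟨ cancel (ℤ.- a *ℤ g) (+ r) ⟩
    (ℤ.- a *ℤ g ℤ.- + r) + + r             ≡⟨ cong (_+ + r) -cdg ⟨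
    ℤ.- c *ℤ (+ d *ℤ g) + + r              <⟨ ℤ.+-monoʳ-< (ℤ.- c *ℤ (+ d *ℤ g)) r<dg ⟩
    ℤ.- c *ℤ (+ d *ℤ g) + + d *ℤ g         ≡⟨ factor (ℤ.- c) (+ d *ℤ g) ⟩
    ℤ.suc (ℤ.- c) *ℤ (+ d *ℤ g)            ∎)
    where
    cancel : ∀ x r → x ≡ (x ℤ.- r) + r
    cancel = ℤ-Ring.solve-∀
    factor : ∀ c n → c *ℤ n + n ≡ (1ℤ + c) *ℤ n
    factor = ℤ-Ring.solve-∀
  i<1+j⇒i≤j : ∀ {i j} → i ℤ.< ℤ.suc j → i ℤ.≤ j
  i<1+j⇒i≤j {i} {j} i<1+j = subst (i ℤ.≤_) (ℤ.pred-suc j) (ℤ.i<j⇒i≤pred[j] i<1+j)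
  Q≡-c : Q ≡ ℤ.- c
  Q≡-c = ℤ.≤-antisym (i<1+j⇒i≤j Q<1-c) (i<1+j⇒i≤j -c<1+Q)

-- `i ℚ./ n` is stored in lowest terms, so the hypothesis about `i` and `n` is rewritten as one
-- about numerator and denominator times their gcd, which is positive because `n` is nonzero.
ceiling-unique : ∀ i n .{{_ : NonZero n}} c r → r < n → c *ℤ + n ≡ i + + r → ceiling (i ℚ./ n) ≡ c
ceiling-unique i n@(suc _) c r r<n eq = trans (ceiling-/ℕ p)
  (neg-/ℕ-unique (↥ p) (↧ₙ p) g {{g>0}} c r
    (subst (+ r ℤ.<_) (sym (ℚ.↧-/ i n)) (ℤ.+<+ r<n))
    (trans (cong (c *ℤ_) (ℚ.↧-/ i n)) (trans eq (cong (_+ + r) (sym (ℚ.↥-/ i n))))))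
  where
  p = i ℚ./ n
  g = ℤ.gcd i (+ n)
  positive : ∀ g′ → ↧ p *ℤ + g′ ≡ + n → ℤ.Positive (+ g′)
  positive zero    dg≡n = contradiction (trans (sym (ℤ.*-zeroʳ (↧ p))) dg≡n) λ ()
  positive (suc _) _    = _
  g>0 : ℤ.Positive g
  g>0 = positive ℤ.∣ g ∣ (ℚ.↧-/ i n)

-- Filtered intervals and sorted lists.

applyUpTo-++ : ∀ {A : Set} (f : ℕ → A) m n →
  applyUpTo f m ++ applyUpTo (f ∘ (m +ℕ_)) n ≡ applyUpTo f (m +ℕ n)
applyUpTo-++ f zero    n = refl
applyUpTo-++ f (suc m) n = cong (f 0 ∷_) (applyUpTo-++ (f ∘ suc) m n)

[0⋯⟩-split : ∀ {a b} → a ≤ b → [ 0 ⋯ b ⟩ ≡ [ 0 ⋯ a ⟩ ++ [ a ⋯ b ⟩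
[0⋯⟩-split {a} {b} a≤b = trans (cong upTo (sym (ℕ.m+[n∸m]≡n a≤b))) (sym (applyUpTo-++ id a (b ∸ a)))

module _ {P : Pred ℕ 0ℓ} (P? : Decidable P) where

  -- Periodicity of `P` makes the filter keep the same positions before and after the shift, and
  -- each kept entry gains `c`.
  sum-filter-shift : ∀ c → (∀ k → P k → P (c +ℕ k)) → (∀ k → P (c +ℕ k) → P k) → ∀ xs →
    sum (filter P? (map (c +ℕ_) xs)) ≡ length (filter P? xs) * c +ℕ sum (filter P? xs)
  sum-filter-shift c to from [] = refl
  sum-filter-shift c to from (x ∷ xs) with P? (c +ℕ x) | P? x
  ... | no _   | no _  = sum-filter-shift c to from xs
  ... | no ¬p  | yes p = contradiction (to x p) ¬p
  ... | yes p  | no ¬p = contradiction (from x p) ¬p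
  ... | yes _  | yes _ = trans (cong (c +ℕ x +ℕ_) (sum-filter-shift c to from xs))
    (rearrange c x (length (filter P? xs)) (sum (filter P? xs)))
    where
    rearrange : ∀ c x l s → c +ℕ x +ℕ (l * c +ℕ s) ≡ c +ℕ l * c +ℕ (x +ℕ s)
    rearrange = ℕ-Ring.solve-∀

  -- The length is the indicator of `P n`; in this form the new term of the sum matches the
  -- increment in `count-suc`.
  sum-filter-[_] : ∀ n → sum (filter P? (n ∷ [])) ≡ n * length (filter P? (n ∷ []))
  sum-filter-[ n ] with P? n
  ... | yes _ = trans (ℕ.+-identityʳ n) (sym (ℕ.*-identityʳ n))
  ... | no  _ = sym (ℕ.*-zeroʳ n)

lookup-mono-≤ : ∀ {xs} → AllPairs _<_ xs → ∀ i k → toℕ i ≤ toℕ k → lookup xs i ≤ lookup xs k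
lookup-mono-≤ (_ ∷ _)     Fin.zero    Fin.zero    _   = ℕ.≤-refl
lookup-mono-≤ (x<xs ∷ _)  Fin.zero    (Fin.suc k) _   = ℕ.<⇒≤ (All.lookup x<xs (∈-lookup k))
lookup-mono-≤ (_ ∷ pairs) (Fin.suc i) (Fin.suc k) i≤k = lookup-mono-≤ pairs i k (s≤s⁻¹ i≤k)

-- Lattice points: column heights `f` against row thresholds `C`.

module Proof (s t q N : ℕ) (s<q : s < q) (1≤t : 1 ≤ t) (t<q : t < q) (t∤q : ¬ (t ∣ q)) where
  open FloorSum s t q N 1≤t t<q t∤q

  f : ℕ → ℕ
  f k = (s +ℕ k * t) ℕ./ q

  -- C m = ⌈ x_m ⌉ + s̄: the shift by s̄ avoids subtraction.
  C : ℕ → ℕ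
  C m = m * q̄ +ℕ count m

  residue-0 : residue 0 ≡ ŝ
  residue-0 = trans (cong (λ n → + n ℤ.%ℕ t) (ℕ.+-identityʳ ŝ)) (ℕ.m%n%n≡m%n s t)

  -- This is `invariant` with `q = q̂ + q̄ * t` substituted. As `residue m < t`, it exhibits
  -- `C m - s̄` as `(m * q - s) / t` rounded up.
  C-residue : ∀ m → C m * t +ℕ ŝ ≡ m * q +ℕ residue m
  C-residue m = begin
    (m * q̄ +ℕ count m) * t +ℕ ŝ              ≡⟨ lhs m q̄ (count m) t ŝ ⟩
    m * q̄ * t +ℕ (ŝ +ℕ count m * t)          ≡⟨ cong (λ r → m * q̄ * t +ℕ (r +ℕ count m * t)) residue-0 ⟨
    m * q̄ * t +ℕ (residue 0 +ℕ count m * t)  ≡⟨ cong (m * q̄ * t +ℕ_) (invariant m) ⟨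
    m * q̄ * t +ℕ (residue m +ℕ m * q̂)        ≡⟨ rhs m q̄ t (residue m) q̂ ⟩
    m * (q̂ +ℕ q̄ * t) +ℕ residue m            ≡⟨ cong (λ n → m * n +ℕ residue m) (ℕ.m≡m%n+[m/n]*n q t) ⟨
    m * q +ℕ residue m                       ∎
    where
    open ≡-Reasoning
    lhs : ∀ m a c t s → (m * a +ℕ c) * t +ℕ s ≡ m * a * t +ℕ (s +ℕ c * t)
    lhs = ℕ-Ring.solve-∀
    rhs : ∀ m a t r b → m * a * t +ℕ (r +ℕ m * b) ≡ m * (b +ℕ a * t) +ℕ r
    rhs = ℕ-Ring.solve-∀

  -- Brings the column side to the shape of `C-residue`, so that both are compared as multiples of
  -- `t` plus the same `ŝ`.
  s+nt : ∀ n → s +ℕ n * t ≡ (n +ℕ s̄) * t +ℕ ŝ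
  s+nt n = trans (cong (_+ℕ n * t) (ℕ.m≡m%n+[m/n]*n s t)) (rearrange ŝ s̄ n t)
    where
    rearrange : ∀ a b n t → a +ℕ b * t +ℕ n * t ≡ (n +ℕ b) * t +ℕ a
    rearrange = ℕ-Ring.solve-∀

  cancel-t : ∀ {m n} → m * t +ℕ ŝ < n * t +ℕ ŝ → m < n
  cancel-t {m} {n} lt = ℕ.*-cancelʳ-< t m n (ℕ.+-cancelʳ-< ŝ (m * t) (n * t) lt)

  f-zero : f 0 ≡ 0
  f-zero = ℕ.m<n⇒m/n≡0 (subst (_< q) (sym (ℕ.+-identityʳ s)) s<q)

  -- The line has slope `t / q < 1`, so the floor rises by at most one per column.
  f-step : ∀ n → f (suc n) ≡ f n ⊎ f (suc n) ≡ suc (f n)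
  f-step n with ℕ.m≤n⇒m<n∨m≡n (ℕ./-monoˡ-≤ q (ℕ.+-monoʳ-≤ s (ℕ.m≤n+m (n * t) t)))
  ... | inj₂ eq = inj₁ (sym eq)
  ... | inj₁ lt = inj₂ (ℕ.≤-antisym (s≤s⁻¹ (ℕ.*-cancelʳ-< q _ _ bound)) lt)
    where
    open ℕ.≤-Reasoning
    swap : ∀ s t x → s +ℕ (t +ℕ x) ≡ t +ℕ (s +ℕ x)
    swap = ℕ-Ring.solve-∀
    bound : f (suc n) * q < suc (suc (f n)) * q
    bound = begin-strict
      f (suc n) * q           ≤⟨ ℕ.m/n*n≤m (s +ℕ suc n * t) q ⟩
      s +ℕ (t +ℕ n * t)       ≡⟨ swap s t (n * t) ⟩
      t +ℕ (s +ℕ n * t)       <⟨ ℕ.+-mono-< t<q (n<[1+n/d]*d (s +ℕ n * t) q) ⟩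
      q +ℕ suc (f n) * q      ∎

  -- A jump to `m` means `s + n * t < m * q ≤ s + suc n * t`, so row `m` is crossed after column `n`
  -- and no later than column `suc n`. The rounding term `residue m < t` costs less than one further
  -- column.
  C-jump : ∀ n → f (suc n) ≡ suc (f n) → C (suc (f n)) ≡ suc n +ℕ s̄
  C-jump n jump = ℕ.≤-antisym (s≤s⁻¹ (cancel-t upper)) (cancel-t lower)
    where
    open ℕ.≤-Reasoning
    m = suc (f n)
    lower : (n +ℕ s̄) * t +ℕ ŝ < C m * t +ℕ ŝ
    lower = begin-strict
      (n +ℕ s̄) * t +ℕ ŝ   ≡⟨ s+nt n ⟨
      s +ℕ n * t          <⟨ n<[1+n/d]*d (s +ℕ n * t) q ⟩
      m * q               ≤⟨ ℕ.m≤m+n (m * q) (residue m) ⟩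
      m * q +ℕ residue m  ≡⟨ C-residue m ⟨
      C m * t +ℕ ŝ        ∎
    upper : C m * t +ℕ ŝ < suc (suc n +ℕ s̄) * t +ℕ ŝ
    upper = begin-strict
      C m * t +ℕ ŝ                   ≡⟨ C-residue m ⟩
      m * q +ℕ residue m             <⟨ ℕ.+-monoʳ-< (m * q) (residue<t m) ⟩
      m * q +ℕ t                     ≡⟨ cong (λ k → k * q +ℕ t) jump ⟨
      f (suc n) * q +ℕ t             ≤⟨ ℕ.+-monoˡ-≤ t (ℕ.m/n*n≤m (s +ℕ suc n * t) q) ⟩
      s +ℕ suc n * t +ℕ t            ≡⟨ cong (_+ℕ t) (s+nt (suc n)) ⟩
      (suc n +ℕ s̄) * t +ℕ ŝ +ℕ t     ≡⟨ rotate ((suc n +ℕ s̄) * t) ŝ t ⟩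
      t +ℕ (suc n +ℕ s̄) * t +ℕ ŝ     ∎
      where
      rotate : ∀ x s t → x +ℕ s +ℕ t ≡ t +ℕ x +ℕ s
      rotate = ℕ-Ring.solve-∀

  -- The points (k , m) of {-s̄,…,n} × {1,…,f n}, separated by the line s + k t = m q.  As s < q, no
  -- point with k < 0 lies below it.
  Σf+ΣC : ∀ n → Σ< f (suc n) +ℕ Σ< (C ∘ suc) (f n) ≡ f n * (suc n +ℕ s̄)
  Σf+ΣC zero = start (f 0) f-zero
    where
    start : ∀ m → m ≡ 0 → m +ℕ Σ< (C ∘ suc) m ≡ m * (1 +ℕ s̄)
    start _ refl = refl
  Σf+ΣC (suc n) = next (f n) (f (suc n)) (Σf+ΣC n) (f-step n) (C-jump n)
    where
    open ≡-Reasoning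
    X = Σ< f (suc n)
    Y = Σ< (C ∘ suc)
    -- `f n` and `f (suc n)` are generalised to `a` and `b` so that the two alternatives of `f-step`
    -- can be matched with `refl`.
    next : ∀ a b → X +ℕ Y a ≡ a * (suc n +ℕ s̄) → b ≡ a ⊎ b ≡ suc a →
           (b ≡ suc a → C (suc a) ≡ suc n +ℕ s̄) →
           X +ℕ b +ℕ Y b ≡ b * (suc (suc n) +ℕ s̄)
    next a .a ih (inj₁ refl) _ = begin
      X +ℕ a +ℕ Y a               ≡⟨ regroup X a (Y a) ⟩
      a +ℕ (X +ℕ Y a)             ≡⟨ cong (a +ℕ_) ih ⟩
      a +ℕ a * (suc n +ℕ s̄)       ≡⟨ ℕ.*-suc a (suc n +ℕ s̄) ⟨
      a * (suc (suc n) +ℕ s̄)      ∎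
      where
      regroup : ∀ x a y → x +ℕ a +ℕ y ≡ a +ℕ (x +ℕ y)
      regroup = ℕ-Ring.solve-∀
    next a .(suc a) ih (inj₂ refl) jump = begin
      X +ℕ suc a +ℕ (Y a +ℕ C (suc a))                   ≡⟨ cong (λ c → X +ℕ suc a +ℕ (Y a +ℕ c)) (jump refl) ⟩
      X +ℕ suc a +ℕ (Y a +ℕ (suc n +ℕ s̄))                ≡⟨ regroup X a (Y a) (suc n +ℕ s̄) ⟩
      X +ℕ Y a +ℕ (suc a +ℕ (suc n +ℕ s̄))                ≡⟨ cong (_+ℕ (suc a +ℕ (suc n +ℕ s̄))) ih ⟩
      a * (suc n +ℕ s̄) +ℕ (suc a +ℕ (suc n +ℕ s̄))        ≡⟨ factor a (suc n +ℕ s̄) ⟩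
      suc a * (suc (suc n) +ℕ s̄)                         ∎
      where
      regroup : ∀ x a y z → x +ℕ suc a +ℕ (y +ℕ z) ≡ x +ℕ y +ℕ (suc a +ℕ z)
      regroup = ℕ-Ring.solve-∀
      factor : ∀ a z → a * z +ℕ (suc a +ℕ z) ≡ suc a * suc z
      factor = ℕ-Ring.solve-∀

  -- Sums over `H` and summation by parts.

  sum-H-split : ∀ {a b} → a ≤ b → sum H∩[ 0 ⋯ b ⟩ ≡ sum H∩[ 0 ⋯ a ⟩ +ℕ sum H∩[ a ⋯ b ⟩
  sum-H-split {a} {b} a≤b = trans
    (cong sum (trans (cong (filter H?) ([0⋯⟩-split a≤b)) (filter-++ H? [ 0 ⋯ a ⟩ [ a ⋯ b ⟩)))
    (sum-++ H∩[ 0 ⋯ a ⟩ H∩[ a ⋯ b ⟩)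

  sum-H-suc : ∀ n → sum H∩[ 0 ⋯ suc n ⟩ ≡ sum H∩[ 0 ⋯ n ⟩ +ℕ sum (filter H? (n ∷ []))
  sum-H-suc n = trans
    (cong sum (trans (cong (filter H?) (sym (upTo-∷ʳ n))) (filter-++ H? (upTo n) (n ∷ []))))
    (sum-++ H∩[ 0 ⋯ n ⟩ (filter H? (n ∷ [])))

  -- Summation by parts: C increases by q̄ at each step and by 1 more after each element of H.
  ΣC-by-parts : ∀ m → Σ< (C ∘ suc) m +ℕ q̄ * Σ< id m +ℕ sum H∩[ 0 ⋯ m ⟩ ≡ m * C m
  ΣC-by-parts zero    = cong (_+ℕ 0) (ℕ.*-zeroʳ q̄)
  ΣC-by-parts (suc m) = begin
    Y +ℕ C′ +ℕ q̄ * (T +ℕ m) +ℕ sum H∩[ 0 ⋯ suc m ⟩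
      ≡⟨ cong (Y +ℕ C′ +ℕ q̄ * (T +ℕ m) +ℕ_) (trans (sum-H-suc m) (cong (K +ℕ_) (sum-filter-[_] H? m))) ⟩
    Y +ℕ C′ +ℕ q̄ * (T +ℕ m) +ℕ (K +ℕ m * c)
      ≡⟨ regroup Y C′ q̄ T m K c ⟩
    Y +ℕ q̄ * T +ℕ K +ℕ (C′ +ℕ m * (q̄ +ℕ c))
      ≡⟨ cong (_+ℕ (C′ +ℕ m * (q̄ +ℕ c))) (ΣC-by-parts m) ⟩
    m * C m +ℕ (C′ +ℕ m * (q̄ +ℕ c))
      ≡⟨ factor m (C m) C′ (q̄ +ℕ c) ⟩
    C′ +ℕ m * (C m +ℕ (q̄ +ℕ c))
      ≡⟨ cong (λ x → C′ +ℕ m * x) C-suc ⟨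
    C′ +ℕ m * C′ ∎
    where
    open ≡-Reasoning
    Y = Σ< (C ∘ suc) m
    C′ = C (suc m)
    T = Σ< id m
    K = sum H∩[ 0 ⋯ m ⟩
    c = length (filter H? (m ∷ []))
    expand : ∀ m q a c → q +ℕ m * q +ℕ (a +ℕ c) ≡ m * q +ℕ a +ℕ (q +ℕ c)
    expand = ℕ-Ring.solve-∀
    C-suc : C′ ≡ C m +ℕ (q̄ +ℕ c)
    C-suc = trans (cong (suc m * q̄ +ℕ_) (count-suc m)) (expand m q̄ (count m) c)
    regroup : ∀ y d q u m k c → y +ℕ d +ℕ q * (u +ℕ m) +ℕ (k +ℕ m * c) ≡ y +ℕ q * u +ℕ k +ℕ (d +ℕ m * (q +ℕ c))
    regroup = ℕ-Ring.solve-∀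
    factor : ∀ m c d z → m * c +ℕ (d +ℕ m * z) ≡ d +ℕ m * (c +ℕ z)
    factor = ℕ-Ring.solve-∀

  -- The general formula for `S⁺`.

  -- By `C-residue`, `(C M - s̄) * t` exceeds `M * q - s` by `residue M`, a valid remainder for
  -- `ceiling-unique`.
  ⌈xM⌉ : ceiling xM ≡ + C M ℤ.- + s̄
  ⌈xM⌉ = ceiling-unique (+ M *ℤ + q ℤ.- + s) t (+ C M ℤ.- + s̄) (residue M) (residue<t M) (begin
    (+ C M ℤ.- + s̄) *ℤ + t
      ≡⟨ lhs (+ C M) (+ s̄) (+ t) (+ ŝ) ⟩
    -- Adding and subtracting `ŝ` produces the left side of `C-residue` and the division of `s` by
    -- `t`.
    (+ C M *ℤ + t + + ŝ) ℤ.- (+ ŝ + + s̄ *ℤ + t)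
      ≡⟨ cong₂ ℤ._-_ (cong (_+ + ŝ) (sym (ℤ.pos-* (C M) t))) (cong (λ x → + ŝ + x) (sym (ℤ.pos-* s̄ t))) ⟩
    + (C M * t +ℕ ŝ) ℤ.- + (ŝ +ℕ s̄ * t)
      ≡⟨ cong₂ (λ x y → + x ℤ.- + y) (C-residue M) (sym (ℕ.m≡m%n+[m/n]*n s t)) ⟩
    + (M * q +ℕ residue M) ℤ.- + s
      ≡⟨ cong (λ x → (x + + residue M) ℤ.- + s) (ℤ.pos-* M q) ⟩
    (+ M *ℤ + q + + residue M) ℤ.- + s
      ≡⟨ rhs (+ M *ℤ + q) (+ residue M) (+ s) ⟩
    + M *ℤ + q ℤ.- + s + + residue M ∎)
    where
    open ≡-Reasoning
    lhs : ∀ c b t a → (c ℤ.- b) *ℤ t ≡ (c *ℤ t + a) ℤ.- (a + b *ℤ t)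
    lhs = ℤ-Ring.solve-∀
    rhs : ∀ x r s → (x + r) ℤ.- s ≡ x ℤ.- s + r
    rhs = ℤ-Ring.solve-∀

  -- Eliminates the sum of the `C m` between `Σf+ΣC` and `ΣC-by-parts`; keeping `M * C M` on the
  -- left avoids subtraction in ℕ.
  S⁺-ℕ : S⁺ +ℕ M * C M ≡ M * (suc N +ℕ s̄) +ℕ q̄ * Σ< id M +ℕ sum H∩[ 0 ⋯ M ⟩
  S⁺-ℕ = begin
    S⁺ +ℕ M * C M                ≡⟨ cong₂ _+ℕ_ (sum-map-upTo f (suc N)) (sym (ΣC-by-parts M)) ⟩
    Σ< f (suc N) +ℕ (Y +ℕ A +ℕ K)       ≡⟨ regroup (Σ< f (suc N)) Y A K ⟩
    Σ< f (suc N) +ℕ Y +ℕ A +ℕ K         ≡⟨ cong (λ x → x +ℕ A +ℕ K) (Σf+ΣC N) ⟩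
    M * (suc N +ℕ s̄) +ℕ A +ℕ K   ∎
    where
    open ≡-Reasoning
    Y = Σ< (C ∘ suc) M
    A = q̄ * Σ< id M
    K = sum H∩[ 0 ⋯ M ⟩
    regroup : ∀ x y a k → x +ℕ (y +ℕ a +ℕ k) ≡ x +ℕ y +ℕ a +ℕ k
    regroup = ℕ-Ring.solve-∀

  -- In ℤ the term `M * C M` can be moved across: `M * (N + 1 + s̄) - M * C M` is the ceiling term
  -- of `S`, the shift `s̄` being absorbed by `⌈xM⌉`.
  S⁺≡S+sum-H : + S⁺ ≡ S + + sum H∩[ 0 ⋯ M ⟩
  S⁺≡S+sum-H = begin
    + S⁺
      ≡⟨ add-sub (+ S⁺) (+ (M * C M)) ⟩
    + (S⁺ +ℕ M * C M) ℤ.- + (M * C M)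
      ≡⟨ cong₂ (λ x y → + x ℤ.- y) S⁺-ℕ (ℤ.pos-* M (C M)) ⟩
    (+ (M * (suc N +ℕ s̄)) + + (q̄ * Σ< id M) + K) ℤ.- + M *ℤ + C M
      ≡⟨ cong₂ (λ x y → (x + y + K) ℤ.- + M *ℤ + C M) (ℤ.pos-* M (suc N +ℕ s̄)) (ℤ.pos-* q̄ (Σ< id M)) ⟩
    (+ M *ℤ (1ℤ + + N + + s̄) + + q̄ *ℤ + Σ< id M + K) ℤ.- + M *ℤ + C M
      ≡⟨ regroup (+ M) (+ N) (+ s̄) (+ q̄ *ℤ + Σ< id M) K (+ C M) ⟩
    + q̄ *ℤ + Σ< id M + + M *ℤ (+ N ℤ.- (+ C M ℤ.- + s̄) + 1ℤ) + K
      ≡⟨ cong₂ (λ x y → + q̄ *ℤ x + + M *ℤ (+ N ℤ.- y + 1ℤ) + K) (△≡Σ<id M) ⌈xM⌉ ⟨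
    S + K ∎
    where
    open ≡-Reasoning
    K = + sum H∩[ 0 ⋯ M ⟩
    add-sub : ∀ x y → x ≡ (x + y) ℤ.- y
    add-sub = ℤ-Ring.solve-∀
    regroup : ∀ m n s a k c → (m *ℤ (1ℤ + n + s) + a + k) ℤ.- m *ℤ c ≡ a + m *ℤ (n ℤ.- (c ℤ.- s) + 1ℤ) + k
    regroup = ℤ-Ring.solve-∀

  -- Periodicity of `H` modulo `t`.

  -- The numerator changes by `m * t * q̂`, a multiple of `t`.
  residue-periodic : ∀ m k → residue (m * t +ℕ k) ≡ residue k
  residue-periodic m k = unique-residue (A ℤ.- B ℤ.- + m *ℤ + q̂) (residue<t (m * t +ℕ k)) (residue<t k) (begin
    + residue (m * t +ℕ k) ℤ.- + residue k
      ≡⟨ residue-congruence (m * t +ℕ k) k (+ (m * t)) (cong +_ (ℕ.+-comm (m * t) k)) ⟩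
    (A ℤ.- B) *ℤ + t ℤ.- + (m * t) *ℤ + q̂
      ≡⟨ cong (λ x → (A ℤ.- B) *ℤ + t ℤ.- x *ℤ + q̂) (ℤ.pos-* m t) ⟩
    (A ℤ.- B) *ℤ + t ℤ.- + m *ℤ + t *ℤ + q̂
      ≡⟨ factor A B (+ t) (+ m) (+ q̂) ⟩
    (A ℤ.- B ℤ.- + m *ℤ + q̂) *ℤ + t ∎)
    where
    open ≡-Reasoning
    A = numerator k ℤ./ℕ t
    B = numerator (m * t +ℕ k) ℤ./ℕ t
    factor : ∀ a b t m q → (a ℤ.- b) *ℤ t ℤ.- m *ℤ t *ℤ q ≡ (a ℤ.- b ℤ.- m *ℤ q) *ℤ t
    factor = ℤ-Ring.solve-∀

  H-shift⁺ : ∀ m k → H k → H (m * t +ℕ k)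
  H-shift⁺ m k = subst (_< q̂) (sym (residue-periodic m k))

  H-shift⁻ : ∀ m k → H (m * t +ℕ k) → H k
  H-shift⁻ m k = subst (_< q̂) (residue-periodic m k)

  -- By periodicity this block is `J` translated by `m * t`, and `J` has `q̂` elements.
  sum-H-block : ∀ m → sum H∩[ m * t ⋯ suc m * t ⟩ ≡ q̂ * (m * t) +ℕ sum J
  sum-H-block m = begin
    sum H∩[ m * t ⋯ suc m * t ⟩
      ≡⟨ cong (λ n → sum (filter H? (applyUpTo (m * t +ℕ_) n))) (ℕ.m+n∸n≡m t (m * t)) ⟩
    sum (filter H? (applyUpTo (m * t +ℕ_) t))
      ≡⟨ cong (sum ∘ filter H?) (map-upTo (m * t +ℕ_) t) ⟨
    sum (filter H? (map (m * t +ℕ_) (upTo t)))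
      ≡⟨ sum-filter-shift H? (m * t) (H-shift⁺ m) (H-shift⁻ m) (upTo t) ⟩
    length J * (m * t) +ℕ sum J
      ≡⟨ cong (λ l → l * (m * t) +ℕ sum J) ∣J∣≡q̂ ⟩
    q̂ * (m * t) +ℕ sum J ∎
    where open ≡-Reasoning

  -- Each block repeats `sum J`; the translations by `i * t` for `i < m` add up to the triangular
  -- term.
  sum-H-blocks : ∀ m → sum H∩[ 0 ⋯ m * t ⟩ ≡ m * sum J +ℕ q̂ * t * Σ< id m
  sum-H-blocks zero    = sym (ℕ.*-zeroʳ (q̂ * t))
  sum-H-blocks (suc m) = trans (sum-H-split (ℕ.m≤n+m (m * t) t))
    (trans (cong₂ _+ℕ_ (sum-H-blocks m) (sum-H-block m)) (regroup m (sum J) q̂ t (Σ< id m)))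
    where
    regroup : ∀ m j q t x → m * j +ℕ q * t * x +ℕ (q * (m * t) +ℕ j) ≡ j +ℕ m * j +ℕ q * t * (x +ℕ m)
    regroup = ℕ-Ring.solve-∀

  -- The extreme elements of `J`.

  J-sorted : AllPairs _<_ J
  J-sorted = AllPairs.filter⁺ H? (AllPairs.applyUpTo⁺₁ id t (λ i<k _ → i<k))

  j<t : ∀ i → j i < t
  j<t i = ∈-upTo⁻ (proj₁ (∈-filter⁻ H? {xs = upTo t} (∈-lookup (cast (sym ∣J∣≡q̂) i))))

  j-surjective : ∀ k → k < t → H k → ∃ λ i → j i ≡ k
  j-surjective k k<t h = cast ∣J∣≡q̂ i , trans (cong (lookup J) (Fin.cast-involutive (sym ∣J∣≡q̂) ∣J∣≡q̂ i)) (sym (lookup-index k∈J))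
    where
    k∈J : k ∈ J
    k∈J = ∈-filter⁺ H? (∈-upTo⁺ k<t) h
    i = index k∈J

  j-mono : ∀ i k → toℕ i ≤ toℕ k → j i ≤ j k
  j-mono i k i≤k = lookup-mono-≤ J-sorted _ _
    (subst₂ _≤_ (sym (Fin.toℕ-cast (sym ∣J∣≡q̂) i)) (sym (Fin.toℕ-cast (sym ∣J∣≡q̂) k)) i≤k)

  j-first≤ : ∀ i → j-first ≤ j i
  j-first≤ i = j-mono (fromℕ< 1≤q̂) i (subst (_≤ toℕ i) (sym (Fin.toℕ-fromℕ< 1≤q̂)) z≤n)

  ≤j-last : ∀ i → j i ≤ j-last
  ≤j-last i = j-mono i (fromℕ< q̂∸1<q̂) (subst (toℕ i ≤_) (sym (Fin.toℕ-fromℕ< q̂∸1<q̂)) (ℕ.<⇒≤pred (Fin.toℕ<n i)))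
    where
    q̂∸1<q̂ : q̂ ∸ 1 < q̂
    q̂∸1<q̂ = ℕ.∸-monoʳ-< {q̂} {1} {0} (s≤s z≤n) 1≤q̂

  -- An index below `t` occurs in `J`, whose least entry is `j-first`; any other index is at least
  -- `t`, which exceeds every entry of `J`.
  H⇒j-first≤ : ∀ k → H k → j-first ≤ k
  H⇒j-first≤ k h = by-cases (k ℕ.<? t)
    where
    by-cases : Dec (k < t) → j-first ≤ k
    by-cases (no  k≮t) = ℕ.≤-trans (ℕ.<⇒≤ (j<t (fromℕ< 1≤q̂))) (ℕ.≮⇒≥ k≮t)
    by-cases (yes k<t) = let i , ji≡k = j-surjective k k<t h in subst (j-first ≤_) ji≡k (j-first≤ i)

  H⇒≤j-last : ∀ k → k < t → H k → k ≤ j-last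
  H⇒≤j-last k k<t h = let i , ji≡k = j-surjective k k<t h in subst (_≤ j-last) ji≡k (≤j-last i)

  sum-H-empty : ∀ a b → (∀ k → a ≤ k → k < b → ¬ H k) → sum H∩[ a ⋯ b ⟩ ≡ 0
  sum-H-empty a b ¬H = cong sum (filter-none H?
    (All.applyUpTo⁺₁ (a +ℕ_) (b ∸ a) (λ {i} i<b∸a → ¬H (a +ℕ i) (ℕ.m≤m+n a i) (a+i<b i<b∸a))))
    where
    a+i<b : ∀ {i} → i < b ∸ a → a +ℕ i < b
    a+i<b i<b∸a = ℕ.≰⇒> (ℕ.<⇒≱ i<b∸a ∘ ℕ.m≤n+o⇒m∸n≤o b a)

  sum-H-extend : ∀ {a b} → a ≤ b → (∀ k → a ≤ k → k < b → ¬ H k) → sum H∩[ 0 ⋯ a ⟩ ≡ sum H∩[ 0 ⋯ b ⟩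
  sum-H-extend {a} {b} a≤b ¬H = sym (trans (sum-H-split a≤b)
    (trans (cong (sum H∩[ 0 ⋯ a ⟩ +ℕ_) (sum-H-empty a b ¬H)) (ℕ.+-identityʳ _)))

  -- Evaluation of the sum over `H` in each case.

  case-a : M ≤ j-first → + S⁺ ≡ S
  case-a M≤j = trans S⁺≡S+sum-H (trans (cong (λ k → S + + k) empty) (ℤ.+-identityʳ S))
    where
    empty : sum H∩[ 0 ⋯ M ⟩ ≡ 0
    empty = sum-H-empty 0 M λ k _ k<M h → ℕ.<⇒≱ k<M (ℕ.≤-trans M≤j (H⇒j-first≤ k h))

  -- Between `M` and `t`, in either order, `H` has no element: if `M ≤ t`, such an element would lie
  -- in `J` beyond `j-last`; if `t ≤ M`, subtracting `t` from it would give an element of `H` below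
  -- `j-first`.
  case-b₂ : j-last < M → M ≤ j-first +ℕ t → + S⁺ ≡ S + + sum J
  case-b₂ j<M M≤j+t = trans S⁺≡S+sum-H (cong (λ k → S + + k) sum-H≡sum-J)
    where
    sum-H≡sum-J : sum H∩[ 0 ⋯ M ⟩ ≡ sum J
    sum-H≡sum-J = Sum.[_,_] {C = λ _ → sum H∩[ 0 ⋯ M ⟩ ≡ sum J} before after (ℕ.≤-total M t)
      where
      before : M ≤ t → sum H∩[ 0 ⋯ M ⟩ ≡ sum J
      before M≤t = sum-H-extend M≤t λ k M≤k k<t h → ℕ.<⇒≱ j<M (ℕ.≤-trans M≤k (H⇒≤j-last k k<t h))
      -- The shape required by `H-shift⁻` for a single period.
      1+block : ∀ {k} → t ≤ k → k ≡ 1 * t +ℕ (k ∸ t)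
      1+block {k} t≤k = sym (trans (cong (_+ℕ (k ∸ t)) (ℕ.*-identityˡ t)) (ℕ.m+[n∸m]≡n t≤k))
      gap : ∀ k → t ≤ k → k < M → ¬ H k
      gap k t≤k k<M h = ℕ.<⇒≱ k<M (ℕ.≤-trans M≤j+t (subst (j-first +ℕ t ≤_) (ℕ.m∸n+n≡m t≤k)
        (ℕ.+-monoˡ-≤ t (H⇒j-first≤ (k ∸ t) (H-shift⁻ 1 (k ∸ t) (subst H (1+block t≤k) h))))))
      after : t ≤ M → sum H∩[ 0 ⋯ M ⟩ ≡ sum J
      after t≤M = sym (sum-H-extend t≤M gap)

  -- The interval below `M` is cut at `u * t` into `u` full periods and a tail. Because `u` is
  -- computed from `M ∸ 1`, a positive multiple `M` of `t` leaves its last full period in the tail.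
  case-b₃ : + S⁺ ≡ S + + (u * sum J) + + (q̂ * t) *ℤ △ (+ u) + + sum H∩[ u * t ⋯ M ⟩
  case-b₃ = begin
    + S⁺
      ≡⟨ S⁺≡S+sum-H ⟩
    S + + sum H∩[ 0 ⋯ M ⟩
      ≡⟨ cong (λ k → S + + k) (trans (sum-H-split ut≤M) (cong (_+ℕ K) (sum-H-blocks u))) ⟩
    S + (+ (u * sum J) + + (q̂ * t * Σ< id u) + + K)
      ≡⟨ cong (λ x → S + (+ (u * sum J) + x + + K)) (trans (ℤ.pos-* (q̂ * t) (Σ< id u)) (cong (+ (q̂ * t) *ℤ_) (sym (△≡Σ<id u)))) ⟩
    S + (+ (u * sum J) + + (q̂ * t) *ℤ △ (+ u) + + K)
      ≡⟨ assoc S (+ (u * sum J)) (+ (q̂ * t) *ℤ △ (+ u)) (+ K) ⟩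
    S + + (u * sum J) + + (q̂ * t) *ℤ △ (+ u) + + K ∎
    where
    open ≡-Reasoning
    K = sum H∩[ u * t ⋯ M ⟩
    ut≤M : u * t ≤ M
    ut≤M = ℕ.≤-trans (ℕ.m/n*n≤m (M ∸ 1) t) (ℕ.m∸n≤m M 1)
    assoc : ∀ s a b c → s + (a + b + c) ≡ s + a + b + c
    assoc = ℤ-Ring.solve-∀

theorem9 : (s t q N : ℕ) → s < q → (1≤t : 1 ≤ t) (t<q : t < q) (t∤q : ¬ (t ∣ q)) → gcd t q ≡ 1 →
    let open FloorSum s t q N 1≤t t<q t∤q in
    (M ≤ j-first → + S⁺ ≡ S)
    × (j-first < M → M ≤ j-last → + S⁺ ≡ S + + sum H∩[ 0 ⋯ M ⟩)
    × (j-last < M → M ≤ j-first +ℕ t → + S⁺ ≡ S + + sum J)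
    × (j-last < M → j-first +ℕ t < M →
    + S⁺ ≡ S + + (u * sum J) + + (q̂ * t) *ℤ △ (+ u) + + sum H∩[ u * t ⋯ M ⟩)
theorem9 s t q N s<q 1≤t t<q t∤q _ = case-a , (λ _ _ → S⁺≡S+sum-H) , case-b₂ , (λ _ _ → case-b₃)
  where open Proof s t q N s<q 1≤t t<q t∤q
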